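{- Let $s\geq 2$ and let $n_1>n_2>\cdots>n_s\geq 2$ be integers. Let $X_{n_1,\ldots,n_s}$ be the set of vectors of length $s+1$ consisting of: the vector $(n_1,n_2,\ldots,n_s,1)$; the set $X_s^s=\{(j,\ldots,j,0),(j,\ldots,j,1): j\in\{1,\ldots,n_s\}\}$, where $j$ is repeated in the first $s$ coordinates; and, for each $i\in\{2,\ldots,s\}$, the set $X_{i-1}^s$ of vectors $(\underbrace{n_i+k,\ldots,n_i+k}_{i-1},\underbrace{1,\ldots,1}_{s-i+1},0)$ and $(\underbrace{n_i+k,\ldots,n_i+k}_{i-1},n_i,n_{i+1},\ldots,n_s,1)$ for $k\in\{0,1,\ldots,n_{i-1}-n_i-1\}$. Let $\mathcal B_{n_1,\ldots,n_s}$ consist of all $3$-element subsets $\{\alpha_1,\alpha_2,\alpha_3\}\subseteq X_{n_1,\ldots,n_s}$ such that for every coordinate $j\in\{1,\ldots,s+1\}$ the set $\{\alpha_{1(j)},\alpha_{2(j)},\alpha_{3(j)}\}$ has exactly $2$ elements, together with the additional triple $\{(1,\ldots,1,1,0),(n_s,\ldots,n_s,1,0),(n_s,\ldots,n_s,n_s,0)\}$ (here the first vector has its first $s$ entries equal to $1$; the second has its first $s-1$ entries equal to $n_s$ and $s$-th entry $1$; the third has its first $s$ entries equal to $n_s$; all three have last entry $0$). Then the $3$-uniform bi-hypergraph $\mathcal H_{n_1,\ldots,n_s}=(X_{n_1,\ldots,n_s},\mathcal B_{n_1,\ldots,n_s})$ is a one-realization of $\{n_1,n_2,\ldots,n_s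\}$.
   Context: A bi-hypergraph $(X,\mathcal B)$ is a mixed hypergraph whose $\mathcal C$-edges and $\mathcal D$-edges both equal $\mathcal B$. A strict $k$-coloring is a partition of $X$ into exactly $k$ nonempty classes such that every edge of $\mathcal B$ contains two vertices of a common class and two vertices of distinct classes. The feasible set is the set of $k$ admitting a strict $k$-coloring; the chromatic spectrum lists, for $k=1,\ldots,\max$ of the feasible set, the number of strict $k$-colorings (as partitions). A one-realization of a set $S$ is a mixed hypergraph whose feasible set is $S$ and whose chromatic spectrum has all entries in $\{0,1\}$. $\alpha_{l(j)}$ denotes the $j$-th entry of $\alpha_l$. -}

module Defs where

open import Data.Bool.Base using (if_then_else_)
open import Data.Fin.Base using (Fin; toℕ; fromℕ; inject₁; suc)
open import Data.Fin.Properties using (_<?_)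
open import Data.Irrelevant using ([_])
open import Data.List.Base using (List; []; _∷_; _++_; length; lookup; concatMap; allFin; upTo)
open import Data.List.Membership.Propositional using (_∈_; mapWith∈)
import Data.List.Membership.DecPropositional as DecMembership
open import Data.List.Relation.Unary.All using (All)
open import Data.List.Relation.Unary.Any.Properties using (mapWith∈⁺)
import Data.List.Relation.Unary.Enumerates.Setoid as Enumerates
open import Data.List.Relation.Unary.Unique.Propositional using (Unique)
open import Data.Nat.Base using (ℕ; _≤_; _∸_; _+_) renaming (suc to 1+)
import Data.Nat.Properties as ℕ
open import Data.Product.Base using (_×_; _,_; ∃; ∃-syntax)
open import Data.Refinement.Base using (Refinement; value; _,_)
open import Data.Sum.Base using (_⊎_)
open import Data.Vec.Base as Vec using (Vec; tabulate; replicate; _∷ʳ_)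
import Data.Vec.Properties as Vec
open import Function.Bundles using (_⇔_; Inverse)
open import Function.Construct.Composition using (_⇔-∘_)
open import Function.Construct.Identity using (⇔-id)
open import Function.Construct.Symmetry using (⇔-sym)
open import Function.Definitions using (Surjective)
open import Level using (0ℓ) renaming (suc to lsuc)
open import Relation.Binary.Bundles using (Setoid)
open import Relation.Binary.Definitions using (DecidableEquality)
open import Relation.Binary.PropositionalEquality using (_≡_; _≢_; refl; setoid)
open import Relation.Nullary.Decidable using (does; recompute)
open import Relation.Unary using (Pred; _≐_)

∣_∣≡_ : {A : Set} → Pred A 0ℓ → ℕ → Set
∣ P ∣≡ r = ∃[ xs ] Unique xs × length xs ≡ r × P ≐ (_∈ xs)

image : {A B : Set} → (A → B) → Pred A 0ℓ → Pred B 0ℓ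
image f P y = ∃[ x ] P x × f x ≡ y

IsEnumeration : {A : Set} → List A → Set
IsEnumeration {A} = Enumerates.IsEnumeration (setoid A)

-- The set of entries of a list. Membership proofs are irrelevant, so an entry
-- that occurs several times in the list is a single element of this type.
Elements : {A : Set} → List A → Set
Elements {A} xs = Refinement A (_∈ xs)

elements : {A : Set} (xs : List A) → List (Elements xs)
elements xs = mapWith∈ xs (λ {x} x∈xs → x , [ x∈xs ])

elements-enumerates : {A : Set} → DecidableEquality A → (xs : List A) →
                      IsEnumeration (elements xs)
elements-enumerates _≟_ xs (x , [ x∈xs ]) =
  mapWith∈⁺ _ (x , recompute (x ∈? xs) x∈xs , refl)
  where open DecMembership _≟_ using (_∈?_)

record MixedHypergraph : Set₁ where
  field
    Vertex     : Set
    vertices   : List Vertex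
    enumerates : IsEnumeration vertices
    𝒞 𝒟        : Pred (Pred Vertex 0ℓ) 0ℓ

-- A partition into exactly k nonempty classes is represented by a surjection
-- onto Fin k, taken up to renaming of the colours (see _≈_ below).
record StrictColoring (H : MixedHypergraph) (k : ℕ) : Set₁ where
  open MixedHypergraph H
  field
    color      : Vertex → Fin k
    surjective : Surjective _≡_ _≡_ color
    𝒞-proper   : ∀ E → 𝒞 E → ∃[ x ] ∃[ y ] E x × E y × x ≢ y × color x ≡ color y
    𝒟-proper   : ∀ E → 𝒟 E → ∃[ x ] ∃[ y ] E x × E y × color x ≢ color y

open StrictColoring public using (color)

module _ (H : MixedHypergraph) where
  open MixedHypergraph H

  -- Two strict colourings are the same partition when the same pairs of
  -- vertices share a class.
  strictColorings : ℕ → Setoid (lsuc 0ℓ) 0ℓ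
  strictColorings k = record
    { Carrier       = StrictColoring H k
    ; _≈_           = λ c d → ∀ x y → (color c x ≡ color c y) ⇔ (color d x ≡ color d y)
    ; isEquivalence = record
      { refl  = λ x y → ⇔-id _
      ; sym   = λ p x y → ⇔-sym (p x y)
      ; trans = λ p q x y → q x y ⇔-∘ p x y
      }
    }

  Feasible : Pred ℕ (lsuc 0ℓ)
  Feasible k = StrictColoring H k

  NumberOfStrictColorings : ℕ → ℕ → Set₁
  NumberOfStrictColorings k r = Inverse (strictColorings k) (setoid (Fin r))

  -- The list entry at (zero-based) position i belongs to k = i + 1.
  record IsChromaticSpectrum (rs : List ℕ) : Set₁ where
    field
      length-feasible : Feasible (length rs)
      length-maximal  : ∀ k → Feasible k → k ≤ length rs
      counts          : ∀ i → NumberOfStrictColorings (1+ (toℕ i)) (lookup rs i)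

  record OneRealization (S : Pred ℕ 0ℓ) : Set₁ where
    field
      feasibleSet       : Feasible ≐ S
      spectrum          : List ℕ
      isSpectrum        : IsChromaticSpectrum spectrum
      spectrum-zero-one : All (λ r → r ≡ 0 ⊎ r ≡ 1) spectrum

  Uniform : ℕ → Set₁
  Uniform r = ∀ E → 𝒞 E ⊎ 𝒟 E → ∣ E ∣≡ r

biHypergraph : (V : Set) (vs : List V) → IsEnumeration vs →
               Pred (Pred V 0ℓ) 0ℓ → MixedHypergraph
biHypergraph V vs enum 𝓑 = record
  { Vertex = V ; vertices = vs ; enumerates = enum ; 𝒞 = 𝓑 ; 𝒟 = 𝓑 }

-- Here s = m + 1 and n (zero-based i) is the term n_{i+1} of the sequence.
-- Below, i : Fin m stands for the index i + 2 ∈ {2,…,s}, so that n (inject₁ i)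
-- and n (suc i) are consecutive terms and suc i, as a number, is how many
-- leading coordinates are equal to n (suc i) + k.
module _ {m : ℕ} (n : Fin (1+ m) → ℕ) where

  last : ℕ
  last = n (fromℕ m)

  lower upper : Fin m → ℕ → Vec ℕ (2 + m)
  lower i k = tabulate (λ j → if does (j <? suc i) then n (suc i) + k else 1)   ∷ʳ 0
  upper i k = tabulate (λ j → if does (j <? suc i) then n (suc i) + k else n j) ∷ʳ 1

  X : List (Vec ℕ (2 + m))
  X = (tabulate n ∷ʳ 1)
    ∷ concatMap (λ j → (replicate (1+ m) (1+ j) ∷ʳ 0)
                     ∷ (replicate (1+ m) (1+ j) ∷ʳ 1) ∷ []) (upTo last)
   ++ concatMap (λ i → concatMap (λ k → lower i k ∷ upper i k ∷ [])
                                 (upTo (n (inject₁ i) ∸ n (suc i)))) (allFin m)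

  -- All three vectors lie in X when n is strictly decreasing and m, last ≥ 1.
  extraTriple : List (Vec ℕ (2 + m))
  extraTriple = (replicate (1+ m) 1 ∷ʳ 0)
              ∷ (replicate m last ∷ʳ 1 ∷ʳ 0)
              ∷ (replicate (1+ m) last ∷ʳ 0)
              ∷ []

  𝓑 : Pred (Pred (Elements X) 0ℓ) 0ℓ
  𝓑 E = (∣ E ∣≡ 3 × ∀ j → ∣ image (λ α → Vec.lookup (value α) j) E ∣≡ 2)
      ⊎ E ≐ (λ α → value α ∈ extraTriple)

  𝓗 : MixedHypergraph
  𝓗 = biHypergraph (Elements X) (elements X)
        (elements-enumerates (Vec.≡-dec ℕ._≟_) X) 𝓑

{-# OPTIONS --safe #-}
-- Write n₁ > … > n_s for the terms. Coordinate i takes the values 1,…,n_i on X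
-- and every edge has exactly two values there, so it is a strict n_i-colouring.
-- Conversely let c be strict; each edge receives exactly two colours. The
-- vertices ending in 1 are U a = (min (n_j, a))_j, 1 ≤ a ≤ n₁; those ending in 0
-- are L a (entry a where a < n_j, else 1), 1 ≤ a < n₁, and L′ = (n_s,…,n_s).
-- If c (U 1) ≠ c (L 1), then these are the colours of U n_s, L n_s and L′, with
-- c (L n_s) = c (L′) ≠ c (U n_s); the edge {L n_s, L′, U 1} makes this common
-- colour c (L 1), so the extra triple is monochromatic. So c (U 1) = c (L 1), and
-- each L a has the colour of U a or of U 1. At the first a where it is that of
-- U 1, all U b with b ≥ a share a colour while the earlier U b are distinct, and
-- the edge {U (a-1), U a, L a}, present unless a is a term, forces a = n_i for
-- some i (take a = n₁ if there is none). So c is the partition by coordinate i.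
module Submission where

open import Defs
open import Data.Fin.Base using (Fin; fromℕ) renaming (_<_ to _<ᶠ_)
open import Data.Nat.Base using (ℕ; suc; _+_; _≤_; _<_)
open import Data.Product.Base using (_×_; ∃-syntax)
open import Relation.Binary.PropositionalEquality using (_≡_)

open import Data.Bool.Base using (if_then_else_)
open import Data.Empty using (⊥-elim)
open import Data.Fin.Base using (zero; suc; toℕ; inject₁; fromℕ<) renaming (_≤_ to _≤ᶠ_)
import Data.Fin.Properties as Fin
open import Data.Fin.Relation.Unary.Top using (view; ‵fromℕ; ‵inj₁)
open import Data.Irrelevant using ([_])
open import Data.List.Base using (List; []; _∷_; length; concatMap; allFin; applyUpTo; upTo)
open import Data.List.Membership.Propositional using (_∈_; find; lose)
open import Data.List.Membership.Propositional.Properties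
  using (∈-upTo⁺; ∈-upTo⁻; ∈-allFin; ∈-concatMap⁺; ∈-concatMap⁻; ∈-++⁺ˡ; ∈-++⁺ʳ; ∈-++⁻)
import Data.List.Membership.DecPropositional as DecMembership
open import Data.List.Properties using (length-applyUpTo; lookup-applyUpTo)
open import Data.List.Relation.Unary.All as All using (All)
import Data.List.Relation.Unary.All.Properties as All
open import Data.List.Relation.Unary.AllPairs using ([]; _∷_)
open import Data.List.Relation.Unary.Any using (here; there)
open import Data.List.Relation.Unary.Unique.Propositional using (Unique)
open import Data.Nat.Base using (zero; pred; _⊓_; _∸_; z≤n; s≤s; z<s; s≤s⁻¹; >-nonZero)
open import Data.Nat.Properties
open import Data.Product.Base using (∃; _,_; proj₁; proj₂)
open import Data.Refinement.Base using (value; _,_)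
open import Data.Sum.Base using (_⊎_; inj₁; inj₂; [_,_]′)
open import Data.Vec.Base as Vec using (Vec; _∷_; tabulate; replicate; _∷ʳ_)
import Data.Vec.Properties as Vec
open import Function.Base using (_∘_; const; id)
open import Function.Bundles using (_⇔_; mk⇔; module Equivalence)
open import Function.Consequences.Propositional using (strictlySurjective⇒surjective)
open import Function.Construct.Composition using (_⇔-∘_)
open import Function.Construct.Symmetry using (⇔-sym)
open import Function.Definitions using (Surjective)
open import Level using (0ℓ)
open import Relation.Binary.Definitions using (tri<; tri≈; tri>)
open import Relation.Binary.PropositionalEquality
  using (_≢_; refl; sym; trans; cong; cong₂; subst; ≢-sym)
open import Relation.Nullary using (¬_; Dec; yes; no; contradiction)
open import Relation.Nullary.Decidable using (does; recompute; dec-true; dec-false)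
open import Relation.Unary using (Pred; _≐_)

-- Triples that take exactly two values.

module _ {A : Set} where

  -- The constructor names the equal pair. One inequality is enough, because the other follows along
  -- the equality.
  data Two (x y z : A) : Set where
    eq₁₂ : x ≡ y → x ≢ z → Two x y z
    eq₁₃ : x ≡ z → x ≢ y → Two x y z
    eq₂₃ : y ≡ z → x ≢ y → Two x y z

  Two-resp : ∀ {x y z x′ y′ z′} → x ≡ x′ → y ≡ y′ → z ≡ z′ → Two x′ y′ z′ → Two x y z
  Two-resp refl refl refl t = t

  Two-¬mono : ∀ {x y z} → Two x y z → x ≡ y → ¬ (x ≡ z)
  Two-¬mono (eq₁₂ _ x≢z)    x≡y x≡z = x≢z x≡z
  Two-¬mono (eq₁₃ _ x≢y)    x≡y x≡z = x≢y x≡y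
  Two-¬mono (eq₂₃ _ x≢y)    x≡y x≡z = x≢y x≡y

  third-equals : ∀ {x y z} → Two x y z → x ≢ y → z ≡ x ⊎ z ≡ y
  third-equals (eq₁₂ p _) x≢y = contradiction p x≢y
  third-equals (eq₁₃ p _) _   = inj₁ (sym p)
  third-equals (eq₂₃ p _) _   = inj₂ (sym p)

  first-two-equal : ∀ {x y z} → Two x y z → x ≢ z → y ≢ z → x ≡ y
  first-two-equal (eq₁₂ p _) _   _   = p
  first-two-equal (eq₁₃ p _) x≢z _   = contradiction p x≢z
  first-two-equal (eq₂₃ p _) _   y≢z = contradiction p y≢z

  ∈₁ : {x y z : A} → x ∈ x ∷ y ∷ z ∷ []
  ∈₁ = here refl

  ∈₂ : {x y z : A} → y ∈ x ∷ y ∷ z ∷ []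
  ∈₂ = there (here refl)

  ∈₃ : {x y z : A} → z ∈ x ∷ y ∷ z ∷ []
  ∈₃ = there (there (here refl))

  unique₃ : {x y z : A} → x ≢ y → x ≢ z → y ≢ z → Unique (x ∷ y ∷ z ∷ [])
  unique₃ x≢y x≢z y≢z = (x≢y All.∷ x≢z All.∷ All.[]) ∷ (y≢z All.∷ All.[]) ∷ All.[] ∷ []

  ∣∣≡-resp : ∀ {P Q : Pred A 0ℓ} {r} → P ≐ Q → ∣ Q ∣≡ r → ∣ P ∣≡ r
  ∣∣≡-resp (P⊆Q , Q⊆P) (xs , uniq , len , Q⊆xs , xs⊆Q) =
    xs , uniq , len , Q⊆xs ∘ P⊆Q , Q⊆P ∘ xs⊆Q

  repeated⇒Two : ∀ {x y z : A} → (x ≡ y ⊎ x ≡ z ⊎ y ≡ z) → ¬ (x ≡ y × x ≡ z) → Two x y z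
  repeated⇒Two (inj₁ p)        ¬mono = eq₁₂ p (λ q → ¬mono (p , q))
  repeated⇒Two (inj₂ (inj₁ p)) ¬mono = eq₁₃ p (λ q → ¬mono (q , p))
  repeated⇒Two (inj₂ (inj₂ p)) ¬mono = eq₂₃ p (λ q → ¬mono (q , trans q p))

  ∈-pair-pigeonhole : ∀ {p q a b c : A} → a ∈ p ∷ q ∷ [] → b ∈ p ∷ q ∷ [] → c ∈ p ∷ q ∷ [] →
                      a ≡ b ⊎ a ≡ c ⊎ b ≡ c
  ∈-pair-pigeonhole (here refl)         (here refl)         _                   = inj₁ refl
  ∈-pair-pigeonhole (here refl)         (there (here refl)) (here refl)         = inj₂ (inj₁ refl)
  ∈-pair-pigeonhole (here refl)         (there (here refl)) (there (here refl)) = inj₂ (inj₂ refl)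
  ∈-pair-pigeonhole (there (here refl)) (here refl)         (here refl)         = inj₂ (inj₂ refl)
  ∈-pair-pigeonhole (there (here refl)) (here refl)         (there (here refl)) = inj₂ (inj₁ refl)
  ∈-pair-pigeonhole (there (here refl)) (there (here refl)) _                   = inj₁ refl

module _ {A B : Set} (f : A → B) {x y z : A} where

  Two⇒∣image∣≡2 : Two (f x) (f y) (f z) → ∣ image f (_∈ x ∷ y ∷ z ∷ []) ∣≡ 2
  Two⇒∣image∣≡2 (eq₁₂ p q) = f x ∷ f z ∷ [] , (q All.∷ All.[]) ∷ All.[] ∷ [] , refl ,
    (λ { (_ , here refl , refl)                 → here refl
       ; (_ , there (here refl) , refl)         → here (sym p)
       ; (_ , there (there (here refl)) , refl) → there (here refl) }) ,
    (λ { (here refl)         → x , ∈₁ , refl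
       ; (there (here refl)) → z , ∈₃ , refl })
  Two⇒∣image∣≡2 (eq₁₃ p q) = f x ∷ f y ∷ [] , (q All.∷ All.[]) ∷ All.[] ∷ [] , refl ,
    (λ { (_ , here refl , refl)                 → here refl
       ; (_ , there (here refl) , refl)         → there (here refl)
       ; (_ , there (there (here refl)) , refl) → here (sym p) }) ,
    (λ { (here refl)         → x , ∈₁ , refl
       ; (there (here refl)) → y , ∈₂ , refl })
  Two⇒∣image∣≡2 (eq₂₃ p q) = f x ∷ f y ∷ [] , (q All.∷ All.[]) ∷ All.[] ∷ [] , refl ,
    (λ { (_ , here refl , refl)                 → here refl
       ; (_ , there (here refl) , refl)         → there (here refl)
       ; (_ , there (there (here refl)) , refl) → there (here (sym p)) }) ,
    (λ { (here refl)         → x , ∈₁ , refl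
       ; (there (here refl)) → y , ∈₂ , refl })

module _ {A B : Set} (f : A → B) {P : Pred A 0ℓ} where

  -- Pigeonhole: three vertices share two values. This is the form that 𝒞-properness asks for.
  ∣∣≡3∧∣image∣≡2⇒collision : ∣ P ∣≡ 3 → ∣ image f P ∣≡ 2 →
    ∃[ x ] ∃[ y ] P x × P y × x ≢ y × f x ≡ f y
  ∣∣≡3∧∣image∣≡2⇒collision
    (x ∷ y ∷ z ∷ [] , (x≢y All.∷ x≢z All.∷ _) ∷ (y≢z All.∷ _) ∷ _ , refl , _ , xs⊆P)
    (p ∷ q ∷ [] , _ , refl , image⊆pq , _)
    with ∈-pair-pigeonhole (image⊆pq (x , xs⊆P ∈₁ , refl))
                           (image⊆pq (y , xs⊆P ∈₂ , refl))
                           (image⊆pq (z , xs⊆P ∈₃ , refl))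
  ... | inj₁ e        = x , y , xs⊆P ∈₁ , xs⊆P ∈₂ , x≢y , e
  ... | inj₂ (inj₁ e) = x , z , xs⊆P ∈₁ , xs⊆P ∈₃ , x≢z , e
  ... | inj₂ (inj₂ e) = y , z , xs⊆P ∈₂ , xs⊆P ∈₃ , y≢z , e

  ∣image∣≡2⇒separated : ∣ image f P ∣≡ 2 → ∃[ x ] ∃[ y ] P x × P y × f x ≢ f y
  ∣image∣≡2⇒separated (p ∷ q ∷ [] , (p≢q All.∷ _) ∷ _ , refl , _ , pq⊆image)
    with pq⊆image (here refl) | pq⊆image (there (here refl))
  ... | x , Px , refl | y , Py , refl = x , y , Px , Py , p≢q

  image-resp : ∀ {Q : Pred A 0ℓ} → P ≐ Q → image f P ≐ image f Q
  image-resp (P⊆Q , Q⊆P) = (λ (x , Px , e) → x , P⊆Q Px , e) , (λ (x , Qx , e) → x , Q⊆P Qx , e)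

module _ {A B : Set} (f : A → B) {x y z : A} where

  -- The two premises are what 𝒞-properness and 𝒟-properness give on an edge listed as `x`, `y`,
  -- `z`: the first supplies an equal pair, the second excludes a constant triple.
  collision∧separation⇒Two :
    ∃[ a ] ∃[ b ] a ∈ x ∷ y ∷ z ∷ [] × b ∈ x ∷ y ∷ z ∷ [] × a ≢ b × f a ≡ f b →
    ∃[ a ] ∃[ b ] a ∈ x ∷ y ∷ z ∷ [] × b ∈ x ∷ y ∷ z ∷ [] × f a ≢ f b →
    Two (f x) (f y) (f z)
  collision∧separation⇒Two (a , b , a∈ , b∈ , a≢b , e) (a′ , b′ , a′∈ , b′∈ , fa′≢fb′) =
    repeated⇒Two (repeated a∈ b∈ a≢b e)
      (λ mono → fa′≢fb′ (trans (constant mono a′∈) (sym (constant mono b′∈))))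
    where
    repeated : ∀ {a b} → a ∈ x ∷ y ∷ z ∷ [] → b ∈ x ∷ y ∷ z ∷ [] → a ≢ b → f a ≡ f b →
               f x ≡ f y ⊎ f x ≡ f z ⊎ f y ≡ f z
    repeated (here refl)                 (here refl)                 a≢b e = contradiction refl a≢b
    repeated (here refl)                 (there (here refl))         a≢b e = inj₁ e
    repeated (here refl)                 (there (there (here refl))) a≢b e = inj₂ (inj₁ e)
    repeated (there (here refl))         (here refl)                 a≢b e = inj₁ (sym e)
    repeated (there (here refl))         (there (here refl))         a≢b e = contradiction refl a≢b
    repeated (there (here refl))         (there (there (here refl))) a≢b e = inj₂ (inj₂ e)
    repeated (there (there (here refl))) (here refl)                 a≢b e = inj₂ (inj₁ (sym e))
    repeated (there (there (here refl))) (there (here refl))         a≢b e = inj₂ (inj₂ (sym e))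
    repeated (there (there (here refl))) (there (there (here refl))) a≢b e = contradiction refl a≢b

    constant : f x ≡ f y × f x ≡ f z → ∀ {a} → a ∈ x ∷ y ∷ z ∷ [] → f a ≡ f x
    constant _             (here refl)                 = refl
    constant (fx≡fy , _)   (there (here refl))         = sym fx≡fy
    constant (_     , fx≡fz) (there (there (here refl))) = sym fx≡fz

module _ {C : Set} where

  -- The first triple puts `u` into one of the two colours `u₁`, `l₁`. Of the other two triples, the
  -- one in which `u` repeats a colour bars `l` from that colour, and the remaining one leaves `l`
  -- only the other.
  opposite : {u₁ l₁ u l : C} → u₁ ≢ l₁ → Two u₁ u l₁ → Two u₁ u l → Two l₁ l u →
             (u ≡ u₁ × l ≡ l₁) ⊎ (u ≡ l₁ × l ≡ u₁)
  opposite u₁≢l₁ (eq₁₃ p _)    _           _           = ⊥-elim (u₁≢l₁ p)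
  opposite u₁≢l₁ (eq₁₂ refl _) (eq₁₂ _ _)  (eq₁₂ p _)  = inj₁ (refl , sym p)
  opposite u₁≢l₁ (eq₁₂ refl _) (eq₁₂ _ _)  (eq₁₃ p _)  = ⊥-elim (u₁≢l₁ (sym p))
  opposite u₁≢l₁ (eq₁₂ refl _) (eq₁₂ _ q)  (eq₂₃ p _)  = ⊥-elim (q (sym p))
  opposite u₁≢l₁ (eq₁₂ refl _) (eq₁₃ _ q)  _           = ⊥-elim (q refl)
  opposite u₁≢l₁ (eq₁₂ refl _) (eq₂₃ _ q)  _           = ⊥-elim (q refl)
  opposite u₁≢l₁ (eq₂₃ refl _) (eq₁₂ p _)  _           = ⊥-elim (u₁≢l₁ p)
  opposite u₁≢l₁ (eq₂₃ refl _) (eq₁₃ p _)  _           = inj₂ (refl , sym p)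
  opposite u₁≢l₁ (eq₂₃ refl _) (eq₂₃ refl _) (eq₁₂ _ q) = ⊥-elim (q refl)
  opposite u₁≢l₁ (eq₂₃ refl _) (eq₂₃ refl _) (eq₁₃ _ q) = ⊥-elim (q refl)
  opposite u₁≢l₁ (eq₂₃ refl _) (eq₂₃ refl _) (eq₂₃ _ q) = ⊥-elim (q refl)

  -- If `u₁` and `l₁` differed, `opposite` would give `l` and `l′` a common colour, both being
  -- opposite to `u`. The triple with `l₁` excludes `l₁` as this colour, and the triple with `u₁`
  -- excludes `u₁`.
  bit-independent : {u₁ l₁ u l l′ : C} → Dec (u₁ ≡ l₁) →
    Two u₁ u l₁ → Two u₁ u l → Two l₁ l u → Two u₁ u l′ → Two l₁ l′ u → Two l l′ u₁ →
    Two l₁ l l′ → l₁ ≡ u₁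
  bit-independent (yes p) _ _ _ _ _ _ _ = sym p
  bit-independent (no ne) u₁ul₁ u₁ul l₁lu u₁ul′ l₁l′u ll′u₁ l₁ll′
    with opposite ne u₁ul₁ u₁ul l₁lu | opposite ne u₁ul₁ u₁ul′ l₁l′u
  ... | inj₁ (_ , p) | inj₁ (_ , q) = ⊥-elim (Two-¬mono l₁ll′ (sym p) (sym q))
  ... | inj₁ (p , _) | inj₂ (q , _) = ⊥-elim (ne (trans (sym p) q))
  ... | inj₂ (p , _) | inj₁ (q , _) = ⊥-elim (ne (trans (sym q) p))
  ... | inj₂ (_ , p) | inj₂ (_ , q) = ⊥-elim (Two-¬mono ll′u₁ (trans p (sym q)) p)

-- Auxiliary facts on surjections, vectors and sequences.

value-injective : ∀ {A : Set} {xs : List A} {x y : Elements xs} → value x ≡ value y → x ≡ y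
value-injective {x = _ , [ _ ]} {_ , [ _ ]} refl = refl

indicator : {P : Set} → Dec P → ℕ
indicator (yes _) = 1
indicator (no  _) = 0

indicator-01 : {P : Set} (P? : Dec P) → indicator P? ≡ 0 ⊎ indicator P? ≡ 1
indicator-01 (yes _) = inj₂ refl
indicator-01 (no  _) = inj₁ refl

-- A section of `f` followed by `g` is injective.
kernel⊆⇒≤ : ∀ {A : Set} {k l} {f : A → Fin k} {g : A → Fin l} → Surjective _≡_ _≡_ f →
            (∀ x y → g x ≡ g y → f x ≡ f y) → k ≤ l
kernel⊆⇒≤ {f = f} {g} surj ker = Fin.injective⇒≤ {f = g ∘ section} λ {i} {j} e →
  trans (sym (proj₂ (surj i) refl)) (trans (ker _ _ e) (proj₂ (surj j) refl))
  where section = proj₁ ∘ surj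

module _ {A : Set} where

  lookup-∷ʳ-inject₁ : ∀ {k} (xs : Vec A k) x i → Vec.lookup (xs ∷ʳ x) (inject₁ i) ≡ Vec.lookup xs i
  lookup-∷ʳ-inject₁ (_ ∷ _)  x zero    = refl
  lookup-∷ʳ-inject₁ (_ ∷ xs) x (suc i) = lookup-∷ʳ-inject₁ xs x i

  lookup-∷ʳ-fromℕ : ∀ {k} (xs : Vec A k) x → Vec.lookup (xs ∷ʳ x) (fromℕ k) ≡ x
  lookup-∷ʳ-fromℕ Vec.[]   x = refl
  lookup-∷ʳ-fromℕ (_ ∷ xs) x = lookup-∷ʳ-fromℕ xs x

  tabulate-replicate : ∀ {k} {f : Fin k → A} {x} → (∀ i → f i ≡ x) → tabulate f ≡ replicate k x
  tabulate-replicate {zero}  eq = refl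
  tabulate-replicate {suc k} eq = cong₂ _∷_ (eq zero) (tabulate-replicate (eq ∘ suc))

  tabulate-replicate-∷ʳ : ∀ {k} {f : Fin (suc k) → A} {x y} → (∀ i → f (inject₁ i) ≡ x) →
                          f (fromℕ k) ≡ y → tabulate f ≡ replicate k x ∷ʳ y
  tabulate-replicate-∷ʳ {zero}  eq eq′ = cong (_∷ Vec.[]) eq′
  tabulate-replicate-∷ʳ {suc k} {f} eq eq′ = cong₂ _∷_ (eq zero) (tabulate-replicate-∷ʳ {f = f ∘ suc} (eq ∘ suc) eq′)

-- Descend along the terms to the first one that is at most `a`; the term before it exceeds `a`.
-- This locates the block of `X` that holds `U a` and `L a`.
bracket : ∀ {m} (n : Fin (suc m) → ℕ) a → n (fromℕ m) ≤ a → a < n zero →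
          ∃[ i ] n (suc i) ≤ a × a < n (inject₁ i)
bracket {zero}  n a n≤a a<n = contradiction n≤a (<⇒≱ a<n)
bracket {suc m} n a n≤a a<n with n (suc zero) ≤? a
... | yes n₁≤a = zero , n₁≤a , a<n
... | no  n₁≰a with bracket (n ∘ suc) a n≤a (≰⇒> n₁≰a)
...   | i , lo , hi = suc i , lo , hi

if< : ℕ → ℕ → ℕ
if< a N = if does (a <? N) then a else 1

if<-< : ∀ {a N} → a < N → if< a N ≡ a
if<-< {a} {N} a<N rewrite dec-true (a <? N) a<N = refl

if<-≥ : ∀ {a N} → N ≤ a → if< a N ≡ 1
if<-≥ {a} {N} N≤a rewrite dec-false (a <? N) (≤⇒≯ N≤a) = refl

if<-1 : ∀ N → if< 1 N ≡ 1
if<-1 N with 1 <? N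
... | yes 1<N = if<-< 1<N
... | no  1≮N = if<-≥ (≮⇒≥ 1≮N)

-- The vectors `U a`, `L a` and `L′`, and their identification with `X`.

module _ {m : ℕ} (n : Fin (suc m) → ℕ) where

  vec : (Fin (suc m) → ℕ) → ℕ → Vec ℕ (2 + m)
  vec g b = tabulate g ∷ʳ b

  at : Fin (suc m) → Vec ℕ (2 + m) → ℕ
  at i v = Vec.lookup v (inject₁ i)

  at-vec : ∀ i g b → at i (vec g b) ≡ g i
  at-vec i g b = trans (lookup-∷ʳ-inject₁ (tabulate g) b i) (Vec.lookup∘tabulate g i)

  rowU rowL : ℕ → Fin (suc m) → ℕ
  rowU a j = n j ⊓ a
  rowL a j = if< a (n j)

  rowL′ : Fin (suc m) → ℕ
  rowL′ _ = last n

  -- L and L′ differ at last n: L (last n) ends in 1 before the final 0.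
  U L : ℕ → Vec ℕ (2 + m)
  U a = vec (rowU a) 1
  L a = vec (rowL a) 0

  L′ : Vec ℕ (2 + m)
  L′ = vec rowL′ 0

  -- The bound for `L a` is strict: for decreasing terms, `a = n zero` would give the vector `L 1`
  -- again.
  data Shape : Vec ℕ (2 + m) → Set where
    isU  : ∀ a → 1 ≤ a → a ≤ n zero → Shape (U a)
    isL  : ∀ a → 1 ≤ a → a < n zero → Shape (L a)
    isL′ : Shape L′

  module _ (decr : ∀ i j → i <ᶠ j → n j < n i) (2≤last : 2 ≤ last n) where

    antitone : ∀ {i j} → i ≤ᶠ j → n j ≤ n i
    antitone {i} {j} i≤j with m≤n⇒m<n∨m≡n i≤j
    ... | inj₁ i<j = <⇒≤ (decr i j i<j)
    ... | inj₂ i≡j = ≤-reflexive (cong n (sym (Fin.toℕ-injective i≡j)))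

    n-injective : ∀ {i j} → n i ≡ n j → i ≡ j
    n-injective {i} {j} e with Fin.<-cmp i j
    ... | tri< i<j _ _ = contradiction e (≢-sym (<⇒≢ (decr i j i<j)))
    ... | tri≈ _ i≡j _ = i≡j
    ... | tri> _ _ j<i = contradiction e (<⇒≢ (decr j i j<i))

    last≤ : ∀ j → last n ≤ n j
    last≤ j = antitone (Fin.≤fromℕ j)

    ≤first : ∀ j → n j ≤ n zero
    ≤first j = antitone {zero} {j} z≤n

    2≤ : ∀ j → 2 ≤ n j
    2≤ j = ≤-trans 2≤last (last≤ j)

    1≤ : ∀ j → 1 ≤ n j
    1≤ j = <⇒≤ (2≤ j)

    ≢1 : ∀ j → n j ≢ 1
    ≢1 j = ≢-sym (<⇒≢ (2≤ j))

    n⊓1 : ∀ j → n j ⊓ 1 ≡ 1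
    n⊓1 j = m≥n⇒m⊓n≡n (1≤ j)

    module _ {i : Fin m} {a : ℕ} (lo : n (suc i) ≤ a) (hi : a < n (inject₁ i)) where

      -- For `a` between consecutive terms, `j <ᶠ suc i` holds exactly when `a < n j`. This turns
      -- the tests of position in `lower` and `upper` into the tests of value in `L a` and `U a`.
      <-band : ∀ {j} → j <ᶠ suc i → a < n j
      <-band {j} j<1+i = <-≤-trans hi (antitone
        (subst (toℕ j ≤_) (sym (Fin.toℕ-inject₁ i)) (s≤s⁻¹ j<1+i)))

      ≥-band : ∀ {j} → ¬ (j <ᶠ suc i) → n j ≤ a
      ≥-band j≮1+i = ≤-trans (antitone (≮⇒≥ j≮1+i)) lo

      band-lower : tabulate (λ j → if does (j Fin.<? suc i) then a else 1) ∷ʳ 0 ≡ L a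
      band-lower = cong (_∷ʳ 0) (Vec.tabulate-cong eq)
        where
        eq : ∀ j → (if does (j Fin.<? suc i) then a else 1) ≡ if< a (n j)
        eq j with j Fin.<? suc i
        ... | yes p rewrite dec-true (j Fin.<? suc i) p = sym (if<-< (<-band p))
        ... | no ¬p rewrite dec-false (j Fin.<? suc i) ¬p = sym (if<-≥ (≥-band ¬p))

      band-upper : tabulate (λ j → if does (j Fin.<? suc i) then a else n j) ∷ʳ 1 ≡ U a
      band-upper = cong (_∷ʳ 1) (Vec.tabulate-cong eq)
        where
        eq : ∀ j → (if does (j Fin.<? suc i) then a else n j) ≡ n j ⊓ a
        eq j with j Fin.<? suc i
        ... | yes p rewrite dec-true (j Fin.<? suc i) p = sym (m≥n⇒m⊓n≡n (<⇒≤ (<-band p)))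
        ... | no ¬p rewrite dec-false (j Fin.<? suc i) ¬p = sym (m≤n⇒m⊓n≡m (≥-band ¬p))

    U-first : U (n zero) ≡ tabulate n ∷ʳ 1
    U-first = cong (_∷ʳ 1) (Vec.tabulate-cong (λ j → m≤n⇒m⊓n≡m (≤first j)))

    U-const : ∀ {a} → a ≤ last n → U a ≡ replicate (suc m) a ∷ʳ 1
    U-const a≤ = cong (_∷ʳ 1) (tabulate-replicate (λ j → m≥n⇒m⊓n≡n (≤-trans a≤ (last≤ j))))

    L-const : ∀ {a} → a < last n → L a ≡ replicate (suc m) a ∷ʳ 0
    L-const a< = cong (_∷ʳ 0) (tabulate-replicate (λ j → if<-< (<-≤-trans a< (last≤ j))))

    L′-const : L′ ≡ replicate (suc m) (last n) ∷ʳ 0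
    L′-const = cong (_∷ʳ 0) (tabulate-replicate (λ _ → refl))

    -- All earlier terms exceed `last n`, while the strict test fails at the last term itself. The
    -- result is the second vector of `extraTriple`.
    L-last : L (last n) ≡ replicate m (last n) ∷ʳ 1 ∷ʳ 0
    L-last = cong (_∷ʳ 0) (tabulate-replicate-∷ʳ {f = rowL (last n)}
      (λ j → if<-< (decr (inject₁ j) (fromℕ m) (inject₁<fromℕ j)))
      (if<-≥ {N = last n} ≤-refl))
      where
      inject₁<fromℕ : ∀ {k} (j : Fin k) → inject₁ j <ᶠ fromℕ k
      inject₁<fromℕ {k} j rewrite Fin.toℕ-inject₁ j | Fin.toℕ-fromℕ k = Fin.toℕ<n j

    constants : ℕ → List (Vec ℕ (2 + m))
    constants j = (replicate (suc m) (suc j) ∷ʳ 0) ∷ (replicate (suc m) (suc j) ∷ʳ 1) ∷ []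

    bandPair : Fin m → ℕ → List (Vec ℕ (2 + m))
    bandPair i k = lower n i k ∷ upper n i k ∷ []

    band : Fin m → List (Vec ℕ (2 + m))
    band i = concatMap (bandPair i) (upTo (n (inject₁ i) ∸ n (suc i)))

    X⇒Shape : ∀ {v} → v ∈ X n → Shape v
    X⇒Shape (here refl) = subst Shape U-first (isU _ (1≤ zero) ≤-refl)
    X⇒Shape (there v∈) with ∈-++⁻ (concatMap constants (upTo (last n))) v∈
    ... | inj₁ v∈₁ = fromConstants (find (∈-concatMap⁻ constants v∈₁))
      where
      fromConstants : ∀ {v} → ∃[ j ] j ∈ upTo (last n) × v ∈ constants j → Shape v
      fromConstants (j , j∈ , there (here refl)) =
        subst Shape (U-const j<) (isU (suc j) (s≤s z≤n) (≤-trans j< (last≤ zero)))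
        where j< = ∈-upTo⁻ j∈
      -- A constant vector ending in 0 is `L (suc j)` only while `suc j` is below the last term; at
      -- equality it is `L′`.
      fromConstants (j , j∈ , here refl) with m≤n⇒m<n∨m≡n (∈-upTo⁻ j∈)
      ... | inj₁ 1+j< = subst Shape (L-const 1+j<) (isL (suc j) (s≤s z≤n) (<-≤-trans 1+j< (last≤ zero)))
      ... | inj₂ refl′ = subst (λ a → Shape (replicate (suc m) a ∷ʳ 0)) (sym refl′) (subst Shape L′-const isL′)
    ... | inj₂ v∈₂ with find (∈-concatMap⁻ band {xs = allFin m} v∈₂)
    ...   | i , _ , v∈band with find (∈-concatMap⁻ (bandPair i) v∈band)
    ...     | k , k∈ , v∈pair = fromPair v∈pair
      where
      lo : n (suc i) ≤ n (suc i) + k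
      lo = m≤m+n _ k
      hi : n (suc i) + k < n (inject₁ i)
      hi = subst (n (suc i) + k <_) (m+[n∸m]≡n step) (+-monoʳ-< (n (suc i)) (∈-upTo⁻ k∈))
        where
        step : n (suc i) ≤ n (inject₁ i)
        step = antitone (subst (_≤ suc (toℕ i)) (sym (Fin.toℕ-inject₁ i)) (n≤1+n _))
      pos : 1 ≤ n (suc i) + k
      pos = ≤-trans (1≤ (suc i)) lo
      hi₀ : n (suc i) + k < n zero
      hi₀ = <-≤-trans hi (≤first (inject₁ i))
      fromPair : ∀ {v} → v ∈ bandPair i k → Shape v
      fromPair (here refl)         = subst Shape (sym (band-lower lo hi)) (isL _ pos hi₀)
      fromPair (there (here refl)) = subst Shape (sym (band-upper lo hi)) (isU _ pos (<⇒≤ hi₀))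

    constants⊆X : ∀ {v j} → j < last n → v ∈ constants j → v ∈ X n
    constants⊆X j< v∈ = there (∈-++⁺ˡ (∈-concatMap⁺ constants (lose (∈-upTo⁺ j<) v∈)))

    band⊆X : ∀ {v a} i → n (suc i) ≤ a → a < n (inject₁ i) →
             v ∈ bandPair i (a ∸ n (suc i)) → v ∈ X n
    band⊆X i lo hi v∈ = there (∈-++⁺ʳ (concatMap constants (upTo (last n)))
      (∈-concatMap⁺ band (lose (∈-allFin i)
        (∈-concatMap⁺ (bandPair i) (lose (∈-upTo⁺ (∸-monoˡ-< hi lo)) v∈)))))

    -- Values up to the last term give constant vectors, `n zero` gives the first vector of `X`, and
    -- every other value lies in a block found by `bracket`.
    U∈X : ∀ {a} → 1 ≤ a → a ≤ n zero → U a ∈ X n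
    U∈X {suc a} _ a≤ with suc a ≤? last n
    ... | yes a≤last = constants⊆X a≤last (there (here (U-const a≤last)))
    ... | no  a≰last with m≤n⇒m<n∨m≡n a≤
    ...   | inj₂ refl′ = here (trans (cong U refl′) U-first)
    ...   | inj₁ a<n₁ with bracket n (suc a) (<⇒≤ (≰⇒> a≰last)) a<n₁
    ...     | i , lo , hi = band⊆X i lo hi (there (here (trans (sym (band-upper lo hi))
                (cong (λ b → tabulate (λ j → if does (j Fin.<? suc i) then b else n j) ∷ʳ 1)
                  (sym (m+[n∸m]≡n lo))))))

    L∈X : ∀ {a} → 1 ≤ a → a < n zero → L a ∈ X n
    L∈X {suc a} _ a<n₁ with suc a <? last n
    ... | yes a<last = constants⊆X (<⇒≤ a<last) (here (L-const a<last))
    ... | no  a≮last with bracket n (suc a) (≮⇒≥ a≮last) a<n₁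
    ...   | i , lo , hi = band⊆X i lo hi (here (trans (sym (band-lower lo hi))
                (cong (λ b → tabulate (λ j → if does (j Fin.<? suc i) then b else 1) ∷ʳ 0)
                  (sym (m+[n∸m]≡n lo)))))

    L′∈X : L′ ∈ X n
    -- The index is `pred (last n)`, since `constants j` has entries `suc j`.
    L′∈X = constants⊆X (≤-reflexive eq)
      (here (trans L′-const (cong (λ a → replicate (suc m) a ∷ʳ 0) (sym eq))))
      where
      eq : suc (pred (last n)) ≡ last n
      eq = suc-pred (last n) {{>-nonZero (1≤ (fromℕ m))}}

    -- Vertices and their coordinates.

    Vertex : Set
    Vertex = Elements (X n)

    -- The bounds are irrelevant, so the vertex depends on `a` alone, whichever proofs are supplied.
    u : ∀ a → .(1 ≤ a) → .(a ≤ n zero) → Vertex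
    u a 1≤a a≤n₁ = U a , [ U∈X 1≤a a≤n₁ ]

    l : ∀ a → .(1 ≤ a) → .(a < n zero) → Vertex
    l a 1≤a a<n₁ = L a , [ L∈X 1≤a a<n₁ ]

    l′ : Vertex
    l′ = L′ , [ L′∈X ]

    shape : (α : Vertex) → Shape (value α)
    -- The stored membership proof is irrelevant; deciding membership yields one that can be
    -- analysed.
    shape (v , [ v∈X ]) = X⇒Shape (recompute (v ∈? X n) v∈X)
      where open DecMembership (Vec.≡-dec _≟_) using (_∈?_)

    coord : Fin (suc m) → Vertex → ℕ
    coord i α = at i (value α)

    at-U : ∀ i a → at i (U a) ≡ n i ⊓ a
    at-U i a = at-vec i (rowU a) 1

    at-L : ∀ i a → at i (L a) ≡ if< a (n i)
    at-L i a = at-vec i (rowL a) 0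

    at-L′ : ∀ i → at i L′ ≡ last n
    at-L′ i = at-vec i rowL′ 0

    at-bounds : ∀ {v} i → Shape v → 1 ≤ at i v × at i v ≤ n i
    at-bounds i (isU a 1≤a a≤n₁) rewrite at-U i a =
      ⊓-glb (1≤ i) 1≤a , m⊓n≤m (n i) a
    at-bounds i (isL a 1≤a a<n₁) rewrite at-L i a with a <? n i
    ... | yes a<n rewrite if<-< a<n = 1≤a , <⇒≤ a<n
    ... | no  a≮n rewrite if<-≥ (≮⇒≥ a≮n) = ≤-refl , 1≤ i
    at-bounds i isL′ rewrite at-L′ i = 1≤ (fromℕ m) , last≤ i

    coord-bounds : ∀ i α → 1 ≤ coord i α × coord i α ≤ n i
    coord-bounds i α = at-bounds i (shape α)

    -- Uniformity and the colourings by coordinates.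

    module _ (last<first : last n < n zero) where

      1≤last : 1 ≤ last n
      1≤last = 1≤ (fromℕ m)

      u₁ l₁ uₛ lₛ : Vertex
      u₁ = u 1 ≤-refl (1≤ zero)
      l₁ = l 1 ≤-refl (2≤ zero)
      uₛ = u (last n) 1≤last (<⇒≤ last<first)
      lₛ = l (last n) 1≤last last<first

      extra-≐ : (λ α → value α ∈ extraTriple n) ≐ (_∈ l₁ ∷ lₛ ∷ l′ ∷ [])
      extra-≐ =
        (λ { (here e)                 → here (value-injective (trans e (sym (L-const 2≤last))))
           ; (there (here e))         → there (here (value-injective (trans e (sym L-last))))
           ; (there (there (here e))) → there (there (here (value-injective (trans e (sym L′-const))))) }) ,
        (λ { (here refl)                 → here (L-const 2≤last)
           ; (there (here refl))         → there (here L-last)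
           ; (there (there (here refl))) → there (there (here L′-const)) })

      coord-l₁ : ∀ i → coord i l₁ ≡ 1
      coord-l₁ i = trans (at-L i 1) (if<-1 (n i))

      last≢1 : last n ≢ 1
      last≢1 = ≢1 (fromℕ m)

      -- The entries are 1, `last n`, `last n` if `last n < n i`, and 1, 1, `last n` otherwise. The
      -- final entries of the three vectors are all 0, so this triple is not among the ordinary
      -- edges and needs its own check.
      coord-extra : ∀ i → Two (coord i l₁) (coord i lₛ) (coord i l′)
      coord-extra i = Two-resp (coord-l₁ i) (at-L i (last n)) (at-L′ i) (two (last n <? n i))
        where
        two : Dec (last n < n i) → Two 1 (if< (last n) (n i)) (last n)
        two (yes p) = Two-resp refl (if<-< p) refl (eq₂₃ refl (≢-sym last≢1))
        two (no ¬p) = Two-resp refl (if<-≥ (≮⇒≥ ¬p)) refl (eq₁₂ refl (≢-sym last≢1))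

      ∣extra∣≡3 : ∣ (_∈ l₁ ∷ lₛ ∷ l′ ∷ []) ∣≡ 3
      ∣extra∣≡3 = _ , unique₃ l₁≢lₛ l₁≢l′ lₛ≢l′ , refl , id , id
        where
        l₁≢lₛ : l₁ ≢ lₛ
        l₁≢lₛ e = last≢1 (trans (sym (trans (at-L zero (last n)) (if<-< last<first)))
          (trans (sym (cong (coord zero) e)) (coord-l₁ zero)))
        l₁≢l′ : l₁ ≢ l′
        l₁≢l′ e = last≢1 (trans (sym (at-L′ zero)) (trans (sym (cong (coord zero) e)) (coord-l₁ zero)))
        lₛ≢l′ : lₛ ≢ l′
        lₛ≢l′ e = last≢1 (trans (sym (at-L′ (fromℕ m))) (trans (sym (cong (coord (fromℕ m)) e))
          (trans (at-L (fromℕ m) (last n)) (if<-≥ {N = last n} ≤-refl))))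

      𝓑⇒∣∣≡3 : ∀ {E} → 𝓑 n E → ∣ E ∣≡ 3
      𝓑⇒∣∣≡3 (inj₁ (∣E∣≡3 , _)) = ∣E∣≡3
      𝓑⇒∣∣≡3 {E} (inj₂ E≐extra) = ∣∣≡-resp E≐extra (∣∣≡-resp extra-≐ ∣extra∣≡3)

      𝓑⇒∣image∣≡2 : ∀ {E} i → 𝓑 n E → ∣ image (coord i) E ∣≡ 2
      𝓑⇒∣image∣≡2 i (inj₁ (_ , two)) = two (inject₁ i)
      𝓑⇒∣image∣≡2 i (inj₂ E≐extra) =
        ∣∣≡-resp (image-resp (coord i) E≐extra)
          (∣∣≡-resp (image-resp (coord i) extra-≐) (Two⇒∣image∣≡2 (coord i) (coord-extra i)))

      uniform : Uniform (𝓗 n) 3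
      uniform _ = [ 𝓑⇒∣∣≡3 , 𝓑⇒∣∣≡3 ]′

      pred-coord< : ∀ i α → pred (coord i α) < n i
      pred-coord< i α = ≤-trans (≤-reflexive (suc-pred _ {{>-nonZero (proj₁ (coord-bounds i α))}}))
                                (proj₂ (coord-bounds i α))

      -- Coordinates start at 1 and colours at 0, hence the predecessor.
      coordColor : ∀ i → Vertex → Fin (n i)
      coordColor i α = fromℕ< (pred-coord< i α)

      coordColor-≡ : ∀ i x y → (coordColor i x ≡ coordColor i y) ⇔ (coord i x ≡ coord i y)
      coordColor-≡ i x y = mk⇔
        (λ e → pred-injective {{>-nonZero (proj₁ (coord-bounds i x))}}
                 {{>-nonZero (proj₁ (coord-bounds i y))}}
                 (Fin.fromℕ<-injective _ _ (pred-coord< i x) (pred-coord< i y) e))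
        (λ e → Fin.fromℕ<-cong _ _ (cong pred e) (pred-coord< i x) (pred-coord< i y))

      coordColoring : ∀ i → StrictColoring (𝓗 n) (n i)
      coordColoring i = record
        { color      = coordColor i
        ; surjective = strictlySurjective⇒surjective λ k →
            let k<n₁ = <-≤-trans (Fin.toℕ<n k) (≤first i) in
            -- Coordinate `i` of this vertex is `suc (toℕ k)`, which does not exceed `n i`.
            u (suc (toℕ k)) z<s k<n₁ ,
            Fin.toℕ-injective (trans (Fin.toℕ-fromℕ< (pred-coord< i (u (suc (toℕ k)) z<s k<n₁)))
              (cong pred (trans (at-U i (suc (toℕ k))) (m≥n⇒m⊓n≡n (Fin.toℕ<n k)))))
        ; 𝒞-proper   = λ _ E∈ →
            let x , y , Ex , Ey , x≢y , e =
                  ∣∣≡3∧∣image∣≡2⇒collision (coord i) (𝓑⇒∣∣≡3 E∈) (𝓑⇒∣image∣≡2 i E∈)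
            in x , y , Ex , Ey , x≢y , Equivalence.from (coordColor-≡ i x y) e
        ; 𝒟-proper   = λ _ E∈ →
            let x , y , Ex , Ey , ne = ∣image∣≡2⇒separated (coord i) (𝓑⇒∣image∣≡2 i E∈)
            in x , y , Ex , Ey , ne ∘ Equivalence.to (coordColor-≡ i x y)
        }

      term? : ∀ k → Dec (∃[ i ] n i ≡ k)
      term? k = Fin.any? (λ i → n i ≟ k)

      -- Edges seen by an arbitrary strict colouring `c`.

      module _ {K : ℕ} (c : StrictColoring (𝓗 n) K) where

        𝓑⇒Two : ∀ x y z → 𝓑 n (_∈ x ∷ y ∷ z ∷ []) → Two (color c x) (color c y) (color c z)
        𝓑⇒Two x y z E∈ = collision∧separation⇒Two (color c)
          (StrictColoring.𝒞-proper c _ E∈) (StrictColoring.𝒟-proper c _ E∈)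

        -- The first two vertices share the final entry and the third has another. This settles the
        -- final coordinate and separates the third vertex from the others, so `j` only has to
        -- separate the first two.
        edge : ∀ {x y z} f g h b b′ → value x ≡ vec f b → value y ≡ vec g b → value z ≡ vec h b′ →
               b ≢ b′ → ∀ j → f j ≢ g j → (∀ i → Two (f i) (g i) (h i)) →
               Two (color c x) (color c y) (color c z)
        edge {x} {y} {z} f g h b b′ ex ey ez b≢b′ j fj≢gj two =
          𝓑⇒Two x y z (inj₁ ((_ , unique₃ x≢y (≢-level x f ex) (≢-level y g ey) , refl , id , id) ,
                             (λ i → Two⇒∣image∣≡2 (λ α → Vec.lookup (value α) i) (two-at i))))
          where
          at-≡ : ∀ α k d → value α ≡ vec k d → ∀ i → coord i α ≡ k i
          at-≡ α k d e i = trans (cong (at i) e) (at-vec i k d)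

          level : Vertex → ℕ
          level α = Vec.lookup (value α) (fromℕ (suc m))

          level-≡ : ∀ α k d → value α ≡ vec k d → level α ≡ d
          level-≡ α k d e = trans (cong (λ v → Vec.lookup v (fromℕ (suc m))) e)
                                  (lookup-∷ʳ-fromℕ (tabulate k) d)

          x≢y : x ≢ y
          x≢y e = fj≢gj (trans (sym (at-≡ x f b ex j)) (trans (cong (coord j) e) (at-≡ y g b ey j)))

          ≢-level : ∀ α k → value α ≡ vec k b → α ≢ z
          ≢-level α k eα e = b≢b′ (trans (sym (level-≡ α k b eα)) (trans (cong level e) (level-≡ z h b′ ez)))

          two-at : ∀ i → Two (Vec.lookup (value x) i) (Vec.lookup (value y) i) (Vec.lookup (value z) i)
          two-at i with view i
          ... | ‵fromℕ          =
            Two-resp (level-≡ x f b ex) (level-≡ y g b ey) (level-≡ z h b′ ez) (eq₁₂ refl b≢b′)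
          ... | ‵inj₁ {i = k} _ =
            Two-resp (at-≡ x f b ex k) (at-≡ y g b ey k) (at-≡ z h b′ ez k) (two k)

        cu : ∀ a → .(1 ≤ a) → .(a ≤ n zero) → Fin K
        cu a p q = color c (u a p q)

        cl : ∀ a → .(1 ≤ a) → .(a < n zero) → Fin K
        cl a p q = color c (l a p q)

        cu₁ cl₁ cuₛ clₛ cl′ : Fin K
        cu₁ = color c u₁
        cl₁ = color c l₁
        cuₛ = color c uₛ
        clₛ = color c lₛ
        cl′ = color c l′

        -- Where `a < n i`, the entries of `U a` and `L a` are `a` and that of `U b` is larger.
        -- Elsewhere both `U` entries are `n i`, and `L a` has 1.
        edge-ul : ∀ {a b} (1≤a : 1 ≤ a) (a<b : a < b) (b≤n₁ : b ≤ n zero) →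
                  Two (cu a 1≤a (<⇒≤ (<-≤-trans a<b b≤n₁))) (cu b (≤-trans 1≤a (<⇒≤ a<b)) b≤n₁)
                      (cl a 1≤a (<-≤-trans a<b b≤n₁))
        edge-ul {a} {b} 1≤a a<b b≤n₁ = edge (rowU a) (rowU b) (rowL a) 1 0 refl refl refl (λ ()) zero
          (λ e → <⇒≢ a<b (trans (sym (m≥n⇒m⊓n≡n (<⇒≤ (<-≤-trans a<b b≤n₁))))
            (trans e (m≥n⇒m⊓n≡n b≤n₁))))
          (λ i → two i (a <? n i))
          where
          two : ∀ i → Dec (a < n i) → Two (n i ⊓ a) (n i ⊓ b) (if< a (n i))
          two i (yes a<n) = Two-resp (m≥n⇒m⊓n≡n (<⇒≤ a<n)) refl (if<-< a<n)
            (eq₁₃ refl (<⇒≢ (⊓-pres-m< a<n a<b)))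
          two i (no a≮n) = Two-resp (m≤n⇒m⊓n≡m n≤a) (m≤n⇒m⊓n≡m (≤-trans n≤a (<⇒≤ a<b))) (if<-≥ n≤a)
            (eq₁₂ refl (≢1 i))
            where n≤a = ≮⇒≥ a≮n

        -- Where `n i ≤ b`, the entries of `U b` and `L b` are `n i` and 1, so the entry of `U a`
        -- has to be one of these; `gap` ensures it.
        edge-uul : ∀ {a b} (1≤a : 1 ≤ a) (a<b : a < b) (b<n₁ : b < n zero) →
                   (∀ i → n i ≤ b → a ≡ 1 ⊎ n i ≤ a) →
                   Two (cu a 1≤a (<⇒≤ (<-trans a<b b<n₁))) (cu b (≤-trans 1≤a (<⇒≤ a<b)) (<⇒≤ b<n₁))
                       (cl b (≤-trans 1≤a (<⇒≤ a<b)) b<n₁)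
        edge-uul {a} {b} 1≤a a<b b<n₁ gap = edge (rowU a) (rowU b) (rowL b) 1 0 refl refl refl (λ ()) zero
          (λ e → <⇒≢ a<b (trans (sym (m≥n⇒m⊓n≡n (<⇒≤ (<-trans a<b b<n₁))))
            (trans e (m≥n⇒m⊓n≡n (<⇒≤ b<n₁)))))
          (λ i → two i (b <? n i))
          where
          two : ∀ i → Dec (b < n i) → Two (n i ⊓ a) (n i ⊓ b) (if< b (n i))
          two i (yes b<n) = Two-resp (m≥n⇒m⊓n≡n (<⇒≤ (<-trans a<b b<n))) (m≥n⇒m⊓n≡n (<⇒≤ b<n)) (if<-< b<n)
            (eq₂₃ refl (<⇒≢ a<b))
          two i (no b≮n) with gap i (≮⇒≥ b≮n)
          ... | inj₁ refl = Two-resp (n⊓1 i) (m≤n⇒m⊓n≡m (≮⇒≥ b≮n)) (if<-≥ (≮⇒≥ b≮n))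
            (eq₁₃ refl (≢-sym (≢1 i)))
          ... | inj₂ n≤a = Two-resp (m≤n⇒m⊓n≡m n≤a) (m≤n⇒m⊓n≡m (≮⇒≥ b≮n)) (if<-≥ (≮⇒≥ b≮n))
            (eq₁₂ refl (≢1 i))

        edge-u₁ul : ∀ {b} (1<b : 1 < b) (b<n₁ : b < n zero) →
                    Two cu₁ (cu b (<⇒≤ 1<b) (<⇒≤ b<n₁)) (cl b (<⇒≤ 1<b) b<n₁)
        edge-u₁ul 1<b b<n₁ = edge-uul ≤-refl 1<b b<n₁ (λ _ _ → inj₁ refl)

        L-first≢ : ∀ {b} → 1 < b → b < n zero → if< 1 (n zero) ≢ if< b (n zero)
        L-first≢ 1<b b<n₁ e = <⇒≢ 1<b (trans (sym (if<-1 (n zero))) (trans e (if<-< b<n₁)))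

        edge-l₁lₛuₛ : Two cl₁ clₛ cuₛ
        edge-l₁lₛuₛ = edge (rowL 1) (rowL (last n)) (rowU (last n)) 0 1 refl refl refl (λ ()) zero (L-first≢ 2≤last last<first)
          (λ i → two i (last n <? n i))
          where
          two : ∀ i → Dec (last n < n i) → Two (if< 1 (n i)) (if< (last n) (n i)) (n i ⊓ last n)
          two i (yes p) = Two-resp (if<-1 (n i)) (if<-< p) (m≥n⇒m⊓n≡n (<⇒≤ p)) (eq₂₃ refl (≢-sym last≢1))
          two i (no ¬p) = Two-resp (if<-1 (n i)) (if<-≥ (≮⇒≥ ¬p)) (m≤n⇒m⊓n≡m (≮⇒≥ ¬p))
            (eq₁₂ refl (≢-sym (≢1 i)))

        -- The entries are 1, `b`, 1 throughout. From `b = last n` on, coordinate `fromℕ m` would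
        -- contain only 1.
        edge-l₁lu₁ : ∀ {b} (1<b : 1 < b) (b<last : b < last n) →
                     Two cl₁ (cl b (<⇒≤ 1<b) (<-trans b<last last<first)) cu₁
        edge-l₁lu₁ {b} 1<b b<last = edge (rowL 1) (rowL b) (rowU 1) 0 1 refl refl refl (λ ()) zero
          (L-first≢ 1<b (<-trans b<last last<first))
          (λ i → Two-resp (if<-1 (n i)) (if<-< (<-≤-trans b<last (last≤ i))) (n⊓1 i)
            (eq₁₃ refl (<⇒≢ 1<b)))

        edge-u₁uₛl′ : Two cu₁ cuₛ cl′
        edge-u₁uₛl′ = edge (rowU 1) (rowU (last n)) rowL′ 1 0 refl refl refl (λ ()) zero
          (λ e → last≢1 (trans (sym (m≥n⇒m⊓n≡n (last≤ zero))) (trans (sym e) (n⊓1 zero))))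
          (λ i → Two-resp (n⊓1 i) (m≥n⇒m⊓n≡n (last≤ i)) refl (eq₂₃ refl (≢-sym last≢1)))

        edge-l₁l′uₛ : Two cl₁ cl′ cuₛ
        edge-l₁l′uₛ = edge (rowL 1) rowL′ (rowU (last n)) 0 1 refl refl refl (λ ()) zero
          (λ e → last≢1 (trans (sym e) (if<-1 (n zero))))
          (λ i → Two-resp (if<-1 (n i)) refl (m≥n⇒m⊓n≡n (last≤ i)) (eq₂₃ refl (≢-sym last≢1)))

        edge-l₁l′u₁ : Two cl₁ cl′ cu₁
        edge-l₁l′u₁ = edge (rowL 1) rowL′ (rowU 1) 0 1 refl refl refl (λ ()) zero
          (λ e → last≢1 (trans (sym e) (if<-1 (n zero))))
          (λ i → Two-resp (if<-1 (n i)) refl (n⊓1 i) (eq₁₃ refl (≢-sym last≢1)))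

        edge-lₛl′u₁ : Two clₛ cl′ cu₁
        -- `L (last n)` and `L′` differ only in coordinate `fromℕ m`.
        edge-lₛl′u₁ = edge (rowL (last n)) rowL′ (rowU 1) 0 1 refl refl refl (λ ()) (fromℕ m)
          (λ e → last≢1 (trans (sym e) (if<-≥ {N = last n} ≤-refl)))
          (λ i → two i (last n <? n i))
          where
          two : ∀ i → Dec (last n < n i) → Two (if< (last n) (n i)) (last n) (n i ⊓ 1)
          two i (yes p) = Two-resp (if<-< p) refl (n⊓1 i) (eq₁₂ refl last≢1)
          two i (no ¬p) = Two-resp (if<-≥ (≮⇒≥ ¬p)) refl (n⊓1 i) (eq₁₃ refl (≢-sym last≢1))

        edge-extra : Two cl₁ clₛ cl′
        edge-extra = 𝓑⇒Two l₁ lₛ l′ (inj₂ (proj₂ extra-≐ , proj₁ extra-≐))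

        -- Colours forced by `U 1` and `L 1`.

        l₁-color : cl₁ ≡ cu₁
        l₁-color = bit-independent (cu₁ Fin.≟ cl₁)
          (edge-ul ≤-refl 2≤last (<⇒≤ last<first))
          (edge-u₁ul 2≤last last<first) edge-l₁lₛuₛ edge-u₁uₛl′ edge-l₁l′uₛ edge-lₛl′u₁ edge-extra

        -- Otherwise the edge on `U 1`, `U b`, `L 1` would be monochromatic.
        u-color≢ : ∀ {b} (1<b : 1 < b) (b≤n₁ : b ≤ n zero) → cu b (<⇒≤ 1<b) b≤n₁ ≢ cu₁
        u-color≢ 1<b b≤n₁ e = Two-¬mono (edge-ul ≤-refl 1<b b≤n₁) (sym e) (sym l₁-color)

        l-color : ∀ {b} (1<b : 1 < b) (b<n₁ : b < n zero) →
                  cl b (<⇒≤ 1<b) b<n₁ ≡ cu₁ ⊎ cl b (<⇒≤ 1<b) b<n₁ ≡ cu b (<⇒≤ 1<b) (<⇒≤ b<n₁)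
        l-color 1<b b<n₁ = third-equals (edge-u₁ul 1<b b<n₁) (≢-sym (u-color≢ 1<b (<⇒≤ b<n₁)))

        -- The edge with `U 1` and `U (last n)` leaves two colours for `L′`; the edge with `L 1` and
        -- `U 1` excludes that of `U 1`.
        l′-color : cl′ ≡ cuₛ
        l′-color =
          [ (λ p → ⊥-elim (Two-¬mono edge-l₁l′u₁ (trans l₁-color (sym p)) l₁-color)) , id ]′
          (third-equals edge-u₁uₛl′ (≢-sym (u-color≢ 2≤last (<⇒≤ last<first))))

        -- The first `L` vertex that departs from its `U` partner.

        MatchesBelow : ℕ → Set
        MatchesBelow b = ∀ {a} (1≤a : 1 ≤ a) (a<n₁ : a < n zero) → a < b →
                         cl a 1≤a a<n₁ ≡ cu a 1≤a (<⇒≤ a<n₁)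

        -- The second condition is void for `i = zero`, which covers the case that no `L a` departs
        -- from `U a`.
        Pivot : Fin (suc m) → Set
        Pivot i = MatchesBelow (n i) × ((nᵢ<n₁ : n i < n zero) → cl (n i) (1≤ i) nᵢ<n₁ ≡ cu₁)

        matches-suc : ∀ {b} → MatchesBelow b →
          ((1≤b : 1 ≤ b) (b<n₁ : b < n zero) → cl b 1≤b b<n₁ ≡ cu b 1≤b (<⇒≤ b<n₁)) →
          MatchesBelow (suc b)
        matches-suc below at-b 1≤a a<n₁ a<1+b with m≤n⇒m<n∨m≡n (s≤s⁻¹ a<1+b)
        ... | inj₁ a<b  = below 1≤a a<n₁ a<b
        ... | inj₂ refl = at-b 1≤a a<n₁

        pivot-at : ∀ {b i} → n i ≡ b → MatchesBelow b → (1<b : 1 < b) (b<n₁ : b < n zero) →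
                   cl b (<⇒≤ 1<b) b<n₁ ≡ cu₁ → Pivot i
        pivot-at refl below _ _ e = below , λ _ → e

        -- Let `b = suc a` be no term and let `L b` have the colour of `U 1`. If `b < last n`, the
        -- edge on `L 1`, `L b`, `U 1` is monochromatic. Otherwise the edge on `U a`, `U b`, `L b`
        -- shows three colours.
        pivot-step : ∀ {a} (1≤a : 1 ≤ a) (b<n₁ : suc a < n zero) → MatchesBelow (suc a) →
          cl (suc a) (<⇒≤ (s≤s 1≤a)) b<n₁ ≡ cu₁
            ⊎ cl (suc a) (<⇒≤ (s≤s 1≤a)) b<n₁ ≡ cu (suc a) (<⇒≤ (s≤s 1≤a)) (<⇒≤ b<n₁) →
          Dec (∃[ i ] n i ≡ suc a) → MatchesBelow (2 + a) ⊎ ∃ Pivot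
        pivot-step _   _    below (inj₂ e) _                = inj₁ (matches-suc below (λ _ _ → e))
        pivot-step 1≤a b<n₁ below (inj₁ e) (yes (i , nᵢ≡b)) =
          inj₂ (i , pivot-at nᵢ≡b below (s≤s 1≤a) b<n₁ e)
        pivot-step {a} 1≤a b<n₁ below (inj₁ e) (no b∉n) = ⊥-elim (
          [ (λ b<last → Two-¬mono (edge-l₁lu₁ (s≤s 1≤a) b<last) (trans l₁-color (sym e)) l₁-color)
          , (λ last≤b → rainbow last≤b (edge-uul 1≤a ≤-refl b<n₁ gap))
          ]′ (<-≤-connex (suc a) (last n)))
          where
          gap : ∀ i → n i ≤ suc a → a ≡ 1 ⊎ n i ≤ a
          gap i n≤b = inj₂ (s≤s⁻¹ (≤∧≢⇒< n≤b (λ n≡b → b∉n (i , n≡b))))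

          -- This separates the colour of `U a` from that of `U 1`, which is also that of
          -- `L (suc a)`.
          1<a : last n ≤ suc a → 1 < a
          1<a last≤b = ≤-trans 2≤last (s≤s⁻¹ (≤∧≢⇒< last≤b (λ last≡b → b∉n (fromℕ m , last≡b))))

          rainbow : last n ≤ suc a →
            ¬ Two (cu a 1≤a (<⇒≤ (<⇒≤ b<n₁))) (cu (suc a) z<s (<⇒≤ b<n₁)) (cl (suc a) z<s b<n₁)
          rainbow _      (eq₁₂ p _) =
            Two-¬mono (edge-ul 1≤a ≤-refl (<⇒≤ b<n₁)) p (sym (below 1≤a (<⇒≤ b<n₁) ≤-refl))
          rainbow last≤b (eq₁₃ p _) = u-color≢ (1<a last≤b) (<⇒≤ (<⇒≤ b<n₁)) (trans p e)
          rainbow _      (eq₂₃ p _) = u-color≢ (s≤s 1≤a) (<⇒≤ b<n₁) (trans p e)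

        pivot-below : ∀ b → b ≤ n zero → MatchesBelow b ⊎ ∃ Pivot
        pivot-below 0 _ = inj₁ λ _ _ ()
        pivot-below 1 _ = inj₁ λ { (s≤s _) _ (s≤s ()) }
        -- The search starts here: `L 1` is settled by `l₁-color`, whereas `l-color` applies only to
        -- values above 1.
        pivot-below 2 _ = inj₁ λ { {1} _ _ _ → l₁-color ; {suc (suc _)} _ _ (s≤s (s≤s ())) }
        pivot-below (suc (suc (suc k))) b<n₁ = extend (pivot-below (suc (suc k)) (<⇒≤ b<n₁))
          where
          extend : MatchesBelow (2 + k) ⊎ ∃ Pivot → MatchesBelow (3 + k) ⊎ ∃ Pivot
          extend (inj₁ below) = pivot-step z<s b<n₁ below (l-color (s≤s z<s) b<n₁) (term? (2 + k))
          extend (inj₂ piv)   = inj₂ piv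

        pivot : ∃ Pivot
        pivot with pivot-below (n zero) ≤-refl
        -- No departure was found, so the largest term serves as pivot.
        ... | inj₁ below = zero , below , λ n<n → contradiction n<n (<-irrefl refl)
        ... | inj₂ piv   = piv

        -- The partition determined by a pivot.

        cu-cong : ∀ {a b} .(1≤a : 1 ≤ a) .(a≤n₁ : a ≤ n zero) (e : a ≡ b) →
                  cu a 1≤a a≤n₁ ≡ cu b (subst (1 ≤_) e 1≤a) (subst (_≤ n zero) e a≤n₁)
        cu-cong _ _ refl = refl

        module _ {i} (below : MatchesBelow (n i))
                     (at-n : (nᵢ<n₁ : n i < n zero) → cl (n i) (1≤ i) nᵢ<n₁ ≡ cu₁) where

          -- `L a` has the colour of `U a`, so equality would make the edge on `U a`, `U b`, `L a`
          -- monochromatic.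
          u-distinct : ∀ {a b} (1≤a : 1 ≤ a) (a<b : a < b) (b≤n : b ≤ n i) →
                       cu a 1≤a (<⇒≤ (<-≤-trans a<b (≤-trans b≤n (≤first i)))) ≢
                       cu b (≤-trans 1≤a (<⇒≤ a<b)) (≤-trans b≤n (≤first i))
          u-distinct 1≤a a<b b≤n e = Two-¬mono (edge-ul 1≤a a<b (≤-trans b≤n (≤first i))) e
            (sym (below 1≤a (<-≤-trans a<b (≤-trans b≤n (≤first i))) (<-≤-trans a<b b≤n)))

          -- In the edge on `U (n i)`, `U a`, `L (n i)` the third vertex has the colour of `U 1`,
          -- which neither of the others has.
          u-above : ∀ {a} (n≤a : n i ≤ a) (a≤n₁ : a ≤ n zero) →
                    cu a (≤-trans (1≤ i) n≤a) a≤n₁ ≡ cu (n i) (1≤ i) (≤first i)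
          u-above n≤a a≤n₁ with m≤n⇒m<n∨m≡n n≤a
          ... | inj₂ refl = refl
          ... | inj₁ n<a   = sym (first-two-equal (edge-ul (1≤ i) n<a a≤n₁)
            (λ p → u-color≢ (2≤ i) (≤first i) (trans p (at-n (<-≤-trans n<a a≤n₁))))
            (λ p → u-color≢ (<-trans (2≤ i) n<a) a≤n₁ (trans p (at-n (<-≤-trans n<a a≤n₁)))))

          l-above : ∀ {a} (n≤a : n i ≤ a) (a<n₁ : a < n zero) → cl a (≤-trans (1≤ i) n≤a) a<n₁ ≡ cu₁
          l-above n≤a a<n₁ =
            [ id
            -- `U a` and `U (n zero)` already share a colour, so `L a` cannot have it as well.
            , (λ p → ⊥-elim (Two-¬mono (edge-ul (≤-trans (1≤ i) n≤a) a<n₁ ≤-refl)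
                (trans (u-above n≤a (<⇒≤ a<n₁)) (sym (u-above (≤first i) ≤-refl))) (sym p)))
            ]′ (l-color (≤-trans (2≤ i) n≤a) a<n₁)

          -- `U (at i v)` agrees with `v` in coordinate `i` and represents its class there, so
          -- comparing every vertex with it determines the partition.
          color-shape : ∀ {v} .(v∈X : v ∈ X n) → Shape v → .(p : 1 ≤ at i v) → .(q : at i v ≤ n zero) →
                        color c (v , [ v∈X ]) ≡ cu (at i v) p q
          color-shape _ (isU a 1≤a a≤n₁) _ _ with a ≤? n i
          ... | yes a≤n = cu-cong 1≤a a≤n₁ (sym (trans (at-U i a) (m≥n⇒m⊓n≡n a≤n)))
          ... | no  a≰n = trans (u-above n≤a a≤n₁) (cu-cong (1≤ i) (≤first i) (sym (trans (at-U i a) (m≤n⇒m⊓n≡m n≤a))))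
            where n≤a = <⇒≤ (≰⇒> a≰n)
          color-shape _ (isL a 1≤a a<n₁) _ _ with a <? n i
          ... | yes a<n = trans (below 1≤a a<n₁ a<n) (cu-cong 1≤a (<⇒≤ a<n₁) (sym (trans (at-L i a) (if<-< a<n))))
          ... | no  a≮n = trans (l-above (≮⇒≥ a≮n) a<n₁)
            (cu-cong ≤-refl (1≤ zero) (sym (trans (at-L i a) (if<-≥ (≮⇒≥ a≮n)))))
          color-shape _ isL′ _ _ = trans l′-color (cu-cong 1≤last (<⇒≤ last<first) (sym (at-L′ i)))

          coord≤first : ∀ α → coord i α ≤ n zero
          coord≤first α = ≤-trans (proj₂ (coord-bounds i α)) (≤first i)

          color≡cu : ∀ α → color c α ≡ cu (coord i α) (proj₁ (coord-bounds i α)) (coord≤first α)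
          color≡cu α@(v , [ v∈X ]) = color-shape v∈X (shape α) (proj₁ (coord-bounds i α)) (coord≤first α)

          same-partition : ∀ x y → (color c x ≡ color c y) ⇔ (coord i x ≡ coord i y)
          same-partition x y = mk⇔ to from
            where
            to : color c x ≡ color c y → coord i x ≡ coord i y
            to e with <-cmp (coord i x) (coord i y)
            ... | tri≈ _ p _ = p
            ... | tri< p _ _ = ⊥-elim (u-distinct (proj₁ (coord-bounds i x)) p (proj₂ (coord-bounds i y))
                                 (trans (sym (color≡cu x)) (trans e (color≡cu y))))
            ... | tri> _ _ p = ⊥-elim (u-distinct (proj₁ (coord-bounds i y)) p (proj₂ (coord-bounds i x))
                                 (trans (sym (color≡cu y)) (trans (sym e) (color≡cu x))))
            from : coord i x ≡ coord i y → color c x ≡ color c y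
            from e = trans (color≡cu x) (trans (cu-cong (proj₁ (coord-bounds i x)) (coord≤first x) e) (sym (color≡cu y)))

        classify : ∃[ i ] ∀ x y → (color c x ≡ color c y) ⇔ (coord i x ≡ coord i y)
        classify with pivot
        ... | i , below , at-n = i , same-partition below at-n

        -- Surjections with the same kernel have targets of equal size.
        classified-size : ∀ i → (∀ x y → (color c x ≡ color c y) ⇔ (coord i x ≡ coord i y)) → n i ≡ K
        classified-size i same = ≤-antisym
          (kernel⊆⇒≤ (StrictColoring.surjective (coordColoring i)) (λ x y →
            Equivalence.from (coordColor-≡ i x y) ∘ Equivalence.to (same x y)))
          (kernel⊆⇒≤ (StrictColoring.surjective c) (λ x y →
            Equivalence.from (same x y) ∘ Equivalence.to (coordColor-≡ i x y)))

        feasible⇒term : ∃[ i ] n i ≡ K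
        feasible⇒term = proj₁ classify , classified-size _ (proj₂ classify)

      -- Uniqueness, the feasible set and the spectrum.

      coloring-unique : ∀ {K} (c d : StrictColoring (𝓗 n) K) x y →
                        (color c x ≡ color c y) ⇔ (color d x ≡ color d y)
      coloring-unique c d x y = ⇔-sym (subst CoordKernel i≡j (proj₂ (classify d) x y)) ⇔-∘ proj₂ (classify c) x y
        where
        CoordKernel : Fin (suc m) → Set
        CoordKernel i = (color d x ≡ color d y) ⇔ (coord i x ≡ coord i y)
        i≡j : proj₁ (classify d) ≡ proj₁ (classify c)
        -- The terms are distinct, so the number of colours determines the coordinate.
        i≡j = n-injective (trans (proj₂ (feasible⇒term d)) (sym (proj₂ (feasible⇒term c))))

      feasibleSet : Feasible (𝓗 n) ≐ (λ k → ∃[ i ] n i ≡ k)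
      feasibleSet = feasible⇒term , λ { (i , refl) → coordColoring i }

      count-colorings : ∀ {k} (k∈? : Dec (∃[ i ] n i ≡ k)) →
                        NumberOfStrictColorings (𝓗 n) k (indicator k∈?)
      count-colorings (yes (i , refl)) = record
        { to        = const zero
        ; from      = const (coordColoring i)
        ; to-cong   = const refl
        ; from-cong = λ _ → coloring-unique (coordColoring i) (coordColoring i)
        ; inverse   = (λ { {zero} _ → refl }) , (λ {c} _ → coloring-unique (coordColoring i) c)
        }
      count-colorings (no ∉n) = record
        { to        = λ c → contradiction (feasible⇒term c) ∉n
        ; from      = λ ()
        ; to-cong   = λ {c} _ → contradiction (feasible⇒term c) ∉n
        ; from-cong = λ { {()} }
        ; inverse   = (λ { {()} }) , (λ { {_} {()} })
        }

      -- Positions start at 0, so position `i` counts the colourings with `suc i` colours.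
      count : ℕ → ℕ
      count i = indicator (term? (suc i))

      oneRealization : OneRealization (𝓗 n) (λ k → ∃[ i ] n i ≡ k)
      oneRealization = record
        { feasibleSet       = feasibleSet
        ; spectrum          = spectrum
        ; isSpectrum        = record
          { length-feasible = subst (Feasible (𝓗 n)) (sym length-spectrum) (coordColoring zero)
          ; length-maximal  = λ k c → let i , nᵢ≡k = feasible⇒term c in
              subst (k ≤_) (sym length-spectrum) (subst (_≤ n zero) nᵢ≡k (≤first i))
          ; counts          = λ i → subst (NumberOfStrictColorings (𝓗 n) (suc (toℕ i)))
              (sym (lookup-applyUpTo count (n zero) i)) (count-colorings (term? (suc (toℕ i))))
          }
        ; spectrum-zero-one = All.applyUpTo⁺₂ count (n zero) (λ i → indicator-01 (term? (suc i)))
        }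
        where
        spectrum : List ℕ
        spectrum = applyUpTo count (n zero)
        length-spectrum : length spectrum ≡ n zero
        length-spectrum = length-applyUpTo count (n zero)

theorem2p4 : ∀ (t : ℕ) (n : Fin (2 + t) → ℕ) →
    (∀ i j → i <ᶠ j → n j < n i) →
    2 ≤ n (fromℕ (suc t)) →
    Uniform (𝓗 n) 3 × OneRealization (𝓗 n) (λ k → ∃[ i ] n i ≡ k)
theorem2p4 t n decr 2≤last =
  uniform n decr 2≤last last<first , oneRealization n decr 2≤last last<first
  where
  last<first : last n < n zero
  -- There are `2 + t` terms, so the first and the last index differ.
  last<first = decr zero (fromℕ (suc t)) z<s
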